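{- Let $G\in\mathcal{M}(\mathcal{C})$. Then $G^*\in\mathcal{M}(\mathcal{C})$, where $G^*$ is obtained from $G$ by applying any one of the following three constructions: (1) Given a path $uvw$ on three vertices in $G$ (so $uv,vw\in E(G)$): introduce a new vertex $x$, join $x$ to each of $u,v,w$, and then delete the edge $vw$. (2) Given an edge $vw$ in $G$: introduce a new vertex $x$, join $x$ to both $v$ and $w$, and then apply construction (1) to the path $xvw$ (i.e. introduce a further new vertex $x'$, join $x'$ to each of $x,v,w$, and delete $vw$). (3) Given a path $uvw$ on three vertices in $G$: introduce new vertices $x,y$, join each of $x$ and $y$ to each of $u,v,w$, and then delete the edges $uv$ and $vw$.
   Context: All graphs are finite and simple. $\mathcal{R}(\mathcal{C})$ is the class of graphs $G$ such that every $2$-colouring of the edges of $G$ admits a monochromatic cycle (of any length). $\mathcal{M}(\mathcal{C})$ is the class of graphs in $\mathcal{R}(\mathcal{C})$ no proper subgraph of which is in $\mathcal{R}(\mathcal{C})$. -}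

module Defs where

open import Data.Nat using (ℕ; zero; suc)
open import Data.Fin using (Fin; zero; suc; inject₁; fromℕ)
open import Data.Bool using (Bool)
open import Data.Empty using (⊥)
open import Data.Product using (Σ; ∃; _×_; _,_)
open import Data.Sum using (_⊎_; inj₁; inj₂)
open import Relation.Nullary using (¬_)
open import Relation.Binary.PropositionalEquality using (_≡_)
open import Function.Definitions using (Injective; Surjective)

record Graph : Set₁ where
  field
    n      : ℕ
    Adj    : Fin n → Fin n → Set
    sym    : ∀ {i j} → Adj i j → Adj j i
    irrefl : ∀ {i} → ¬ Adj i i
open Graph public

-- A 2-colouring of the edges of G: a colour for each unordered pair
-- (only its values on edges matter).
record Colouring (G : Graph) : Set where
  field
    col    : Fin (n G) → Fin (n G) → Bool
    colSym : ∀ i j → col i j ≡ col j i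
open Colouring public

MonoCycle : (G : Graph) → Colouring G → Set
MonoCycle G c =
  Σ ℕ λ m → Σ (Fin (suc (suc (suc m))) → Fin (n G)) λ v →
    Injective _≡_ _≡_ v × Σ Bool λ b →
      ((i : Fin (suc (suc m))) →
          Adj G (v (inject₁ i)) (v (suc i)) × col c (v (inject₁ i)) (v (suc i)) ≡ b)
      × (Adj G (v (fromℕ (suc (suc m)))) (v zero) × col c (v (fromℕ (suc (suc m)))) (v zero) ≡ b)

InR : Graph → Set
InR G = (c : Colouring G) → MonoCycle G c

record Subgraph (H G : Graph) : Set where
  field
    emb     : Fin (n H) → Fin (n G)
    embInj  : Injective _≡_ _≡_ emb
    embAdj  : ∀ {i j} → Adj H i j → Adj G (emb i) (emb j)
open Subgraph public

Proper : {H G : Graph} → Subgraph H G → Set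
Proper {H} {G} s =
  ¬ (Surjective _≡_ _≡_ (emb s) × (∀ i j → Adj G (emb s i) (emb s j) → Adj H i j))

InM : Graph → Set₁
InM G = InR G × ((H : Graph) → (s : Subgraph H G) → Proper s → ¬ InR H)

-- Add a new vertex (numbered zero; old vertex i becomes suc i) adjacent to
-- exactly the old vertices satisfying N.
addVertex : (G : Graph) → (Fin (n G) → Set) → Graph
addVertex G N = record { n = suc (n G) ; Adj = A ; sym = λ {i} {j} → s {i} {j} ; irrefl = λ {i} → ir {i} }
  where
  A : Fin (suc (n G)) → Fin (suc (n G)) → Set
  A zero zero = ⊥
  A zero (suc j) = N j
  A (suc i) zero = N i
  A (suc i) (suc j) = Adj G i j
  s : ∀ {i j} → A i j → A j i
  s {zero} {zero} ()
  s {zero} {suc j} p = p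
  s {suc i} {zero} p = p
  s {suc i} {suc j} p = sym G p
  ir : ∀ {i} → ¬ A i i
  ir {zero} ()
  ir {suc i} p = irrefl G p

deleteEdge : (G : Graph) → Fin (n G) → Fin (n G) → Graph
deleteEdge G a b = record { n = n G ; Adj = A ; sym = λ {i} {j} → s {i} {j} ; irrefl = λ {i} → ir {i} }
  where
  A : Fin (n G) → Fin (n G) → Set
  A i j = Adj G i j × ¬ ((i ≡ a × j ≡ b) ⊎ (i ≡ b × j ≡ a))
  s : ∀ {i j} → A i j → A j i
  s {i} {j} (p , q) = sym G p , λ { (inj₁ (x , y)) → q (inj₂ (y , x))
                          ; (inj₂ (x , y)) → q (inj₁ (y , x)) }
  ir : ∀ {i} → ¬ A i i
  ir {i} (p , _) = irrefl G p

con1 : (G : Graph) → (u v w : Fin (n G)) → Graph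
con1 G u v w =
  deleteEdge (addVertex G (λ j → j ≡ u ⊎ j ≡ v ⊎ j ≡ w)) (suc v) (suc w)

con2 : (G : Graph) → (v w : Fin (n G)) → Graph
con2 G v w = con1 (addVertex G (λ j → j ≡ v ⊎ j ≡ w)) zero (suc v) (suc w)

-- Construction (3) on the path uvw: new x, y each joined to u, v, w; delete uv and vw.
-- (x is vertex suc zero, y is vertex zero, old vertex i is suc (suc i).)
con3 : (G : Graph) → (u v w : Fin (n G)) → Graph
con3 G u v w =
  deleteEdge
    (deleteEdge
      (addVertex (addVertex G N) (λ j → j ≡ suc u ⊎ j ≡ suc v ⊎ j ≡ suc w))
      (suc (suc u)) (suc (suc v)))
    (suc (suc v)) (suc (suc w))
  where
  N : Fin (n G) → Set
  N j = j ≡ u ⊎ j ≡ v ⊎ j ≡ w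

IsPath3 : (G : Graph) → Fin (n G) → Fin (n G) → Fin (n G) → Set
IsPath3 G u v w = Adj G u v × Adj G v w × ¬ (u ≡ w)

{-# OPTIONS --safe #-}
module Submission where

-- G is in M(C) iff G has no isolated vertex, no splitting of its edges into two forests, but such a
-- splitting after deleting any edge.  The key fact is that both forests of a splitting of G - e are
-- spanning trees.  To see it, move the uncoloured edge around by exchanging it with an edge on the
-- path that joins its ends in one of the two forests.  The set S of edges that can become uncoloured
-- is connected up by S itself in each forest; if S were a proper part of G, a splitting of S would
-- combine with the given splitting outside S to one of G.  So S is everything.
-- Now a splitting of con1 G u v w restricts to one of G - vw with connected classes, and two of the
-- three edges at the new vertex have the same colour and close a cycle.  Splittings after deleting an
-- edge extend over a new vertex when its neighbours in one colour are not connected in that colour.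

open import Defs
open import Level using (0ℓ)
open import Data.Nat using (ℕ; zero; suc)
open import Data.Fin using (Fin; zero; suc; punchIn; punchOut; inject₁; fromℕ; fromℕ<; toℕ)
open import Data.Fin.Properties
  using (_≟_; any?; suc-injective; fromℕ≢inject₁; injective⇒≤; toℕ-fromℕ<; sequence;
         punchIn-injective; punchInᵢ≢i; punchIn-punchOut; punchOut-injective; punchOut-cong)
open import Data.Bool using (Bool; true; false; not; if_then_else_; _∧_)
import Data.Bool.Properties as Bool
open import Data.Empty using (⊥; ⊥-elim)
open import Data.Product using (∃; Σ-syntax; ∃-syntax; _×_; _,_; proj₁; proj₂; map₁; map₂; swap)
open import Data.Sum as Sum using (_⊎_; inj₁; inj₂)
open import Data.Vec using (Vec; []; lookup; tabulate) renaming (_∷_ to _∷ᵛ_)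
open import Data.Vec.Properties using (lookup∘tabulate)
open import Data.Vec.Functional using (_∷_)
open import Effect.Monad using (RawMonad)
open import Function using (_∘_; id)
open import Function.Definitions using (Injective)
open import Relation.Binary.Core using (Rel; _⇒_)
open import Relation.Binary.Definitions using (Symmetric; Decidable)
open import Relation.Binary.Construct.Closure.ReflexiveTransitive
  using (Star; ε; _◅_; _◅◅_; _⋆; gmap; reverse; return) renaming (map to Star-map)
open import Relation.Binary.PropositionalEquality
  using (_≡_; _≢_; refl; cong; cong₂; subst; subst₂; trans; ≢-sym; module ≡-Reasoning) renaming (sym to ≡-sym)
open import Relation.Nullary using (¬_; Dec; yes; no; does; contradiction)
open import Relation.Nullary.Negation using (¬¬-Monad; ¬¬-map)
open import Relation.Nullary.Decidable
  using (_×-dec_; _⊎-dec_; ¬?; map′; toSum; decidable-stable; ¬¬-excluded-middle; dec-true; dec-false)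

private variable
  k m : ℕ

-- Unordered pairs and deletion of an edge

FinRel : ℕ → Set₁
FinRel k = Rel (Fin k) 0ℓ

SameEdge : (x y a b : Fin k) → Set
SameEdge x y a b = (x ≡ a × y ≡ b) ⊎ (x ≡ b × y ≡ a)

same? : (x y a b : Fin k) → Dec (SameEdge x y a b)
same? x y a b = (x ≟ a ×-dec y ≟ b) ⊎-dec (x ≟ b ×-dec y ≟ a)

same-swapˡ : {x y a b : Fin k} → SameEdge x y a b → SameEdge y x a b
same-swapˡ = Sum.swap ∘ Sum.map swap swap

same-sym : {x y a b : Fin k} → SameEdge x y a b → SameEdge a b x y
same-sym (inj₁ (refl , refl)) = inj₁ (refl , refl)
same-sym (inj₂ (refl , refl)) = inj₂ (refl , refl)

same-cong : (f : Fin m → Fin k) {x y a b : Fin m} → SameEdge x y a b → SameEdge (f x) (f y) (f a) (f b)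
same-cong f = Sum.map (λ (p , q) → cong f p , cong f q) (λ (p , q) → cong f p , cong f q)

-- Spelled so that Adj (deleteEdge G a b) is definitionally del (Adj G) a b.
del : FinRel k → Fin k → Fin k → FinRel k
del T a b x y = T x y × ¬ SameEdge x y a b

del? : {T : FinRel k} → Decidable T → ∀ a b → Decidable (del T a b)
del? T? a b x y = T? x y ×-dec ¬? (same? x y a b)

del-sym : {T : FinRel k} → Symmetric T → ∀ {a b} → Symmetric (del T a b)
del-sym T-sym (t , ne) = T-sym t , ne ∘ same-swapˡ

del-mono : {T U : FinRel k} {a b : Fin k} → T ⇒ U → del T a b ⇒ del U a b
del-mono T⊆U (t , ne) = T⊆U t , ne

-- Walks and forests

-- Simple paths in the format in which Defs spells cycles.
record SimplePath (T : FinRel k) (a b : Fin k) : Set where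
  constructor simple
  field
    len   : ℕ
    vert  : Fin (suc len) → Fin k
    inj   : Injective _≡_ _≡_ vert
    start : vert zero ≡ a
    end   : vert (fromℕ len) ≡ b
    step  : ∀ i → T (vert (inject₁ i)) (vert (suc i))

chain : {T : FinRel k} (l : ℕ) (v : Fin (suc l) → Fin k) →
        (∀ i → T (v (inject₁ i)) (v (suc i))) → Star T (v zero) (v (fromℕ l))
chain zero    v s = ε
chain (suc l) v s = s zero ◅ chain l (v ∘ suc) (s ∘ suc)

path-suffix : {T : FinRel k} {b : Fin k} (l : ℕ) (v : Fin (suc l) → Fin k) →
              Injective _≡_ _≡_ v → v (fromℕ l) ≡ b →
              (∀ i → T (v (inject₁ i)) (v (suc i))) → ∀ i → SimplePath T (v i) b
path-suffix l       v v-inj e s zero    = simple l v v-inj refl e s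
path-suffix (suc l) v v-inj e s (suc i) =
  path-suffix l (v ∘ suc) (suc-injective ∘ v-inj) e (s ∘ suc) i

∷-injective : {a : Fin k} {v : Fin m → Fin k} → (∀ i → v i ≢ a) →
              Injective _≡_ _≡_ v → Injective _≡_ _≡_ (a ∷ v)
∷-injective fresh v-inj {zero}  {zero}  _ = refl
∷-injective fresh v-inj {zero}  {suc j} p = contradiction (≡-sym p) (fresh j)
∷-injective fresh v-inj {suc i} {zero}  p = contradiction p (fresh i)
∷-injective fresh v-inj {suc i} {suc j} p = cong suc (v-inj p)

-- A start vertex that recurs on the simplified tail cuts the walk short: only the part of the tail
-- from that vertex on is kept.
star⇒path : {T : FinRel k} {a b : Fin k} → Star T a b → SimplePath T a b
star⇒path {a = a} ε =
  simple 0 (λ _ → a) (λ { {zero} {zero} _ → refl }) refl refl (λ ())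
star⇒path {T = T} {a} {b} (t ◅ ts)
  with simple l v v-inj refl e s ← star⇒path ts
  with any? (λ i → v i ≟ a)
... | yes (i , refl) = path-suffix l v v-inj e s i
... | no  ne = simple (suc l) (a ∷ v) (∷-injective (λ i q → ne (i , q)) v-inj) refl e
                 λ { zero → t ; (suc i) → s i }

-- Every edge of a simple path is met once, so the rest of the path avoids it.
simple-edges : {T : FinRel k} {a b : Fin k} → Star T a b →
  Star (λ r s → T r s × Star (del T r s) a r × Star (del T r s) s b) a b
simple-edges {k} {T} ts with simple l v v-inj refl refl s ← star⇒path ts =
  Star-map proj₂ (go l v v-inj s)
  where
  -- That `r` and `s` are on the path strengthens the induction: the edge put in front starts at a
  -- vertex off the rest of the path, so it is none of the later edges.
  Traversed : (l : ℕ) → (Fin (suc l) → Fin k) → FinRel k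
  Traversed l v r s = ((∃[ i ] r ≡ v i) × (∃[ j ] s ≡ v j)) ×
                      T r s × Star (del T r s) (v zero) r × Star (del T r s) s (v (fromℕ l))
  go : (l : ℕ) (v : Fin (suc l) → Fin k) → Injective _≡_ _≡_ v →
       (∀ i → T (v (inject₁ i)) (v (suc i))) →
       Star (Traversed l v) (v zero) (v (fromℕ l))
  go zero    v v-inj s = ε
  go (suc l) v v-inj s =
    (((zero , refl) , (suc zero , refl)) , s zero , ε , chain l (v ∘ suc) avoid)
    ◅ Star-map extend (go l (v ∘ suc) (suc-injective ∘ v-inj) (s ∘ suc))
    where
    avoid : ∀ i → del T (v zero) (v (suc zero)) (v (suc (inject₁ i))) (v (suc (suc i)))
    avoid i = s (suc i) , λ
      { (inj₁ (p , _)) → contradiction (v-inj p) λ ()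
      ; (inj₂ (_ , q)) → contradiction (v-inj q) λ () }
    extend : Traversed l (v ∘ suc) ⇒ Traversed (suc l) v
    extend (((i , refl) , (j , refl)) , t , pre , post) =
      ((suc i , refl) , (suc j , refl)) , t , (s zero , new) ◅ pre , post
      where
      new : ¬ SameEdge (v zero) (v (suc zero)) (v (suc i)) (v (suc j))
      new (inj₁ (p , _)) = contradiction (v-inj p) λ ()
      new (inj₂ (p , _)) = contradiction (v-inj p) λ ()

-- Simple paths have fewer than `k` edges, so a bounded search suffices.
star? : {T : FinRel k} → Decidable T → Decidable (Star T)
star? {k} {T} T? a b = map′ to from (any? {n = k} λ l → walk? (toℕ l) a b)
  where
  Walk : ℕ → FinRel k
  Walk zero    a b = a ≡ b
  Walk (suc l) a b = ∃[ c ] T a c × Walk l c b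
  walk? : ∀ l → Decidable (Walk l)
  walk? zero    a b = a ≟ b
  walk? (suc l) a b = any? λ c → T? a c ×-dec walk? l c b
  toStar : ∀ l {a b} → Walk l a b → Star T a b
  toStar zero    refl        = ε
  toStar (suc l) (_ , t , w) = t ◅ toStar l w
  to : (∃[ l ] Walk (toℕ l) a b) → Star T a b
  to (l , w) = toStar (toℕ l) w
  fromPath : ∀ l (v : Fin (suc l) → Fin k) → (∀ i → T (v (inject₁ i)) (v (suc i))) →
             Walk l (v zero) (v (fromℕ l))
  fromPath zero    v s = refl
  fromPath (suc l) v s = v (suc zero) , s zero , fromPath l (v ∘ suc) (s ∘ suc)
  from : Star T a b → ∃[ l ] Walk (toℕ l) a b
  from ts with simple l v v-inj refl refl s ← star⇒path ts =
    fromℕ< l<k , subst (λ j → Walk j (v zero) (v (fromℕ l))) (≡-sym (toℕ-fromℕ< l<k)) (fromPath l v s)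
    where l<k = injective⇒≤ v-inj

-- Every edge is a bridge. For symmetric relations these are the forests, in a form that passes
-- directly to subrelations.
Acyclic : FinRel k → Set
Acyclic T = ∀ {a b} → T a b → ¬ Star (del T a b) a b

acyclic-⊆ : {T U : FinRel k} → U ⇒ T → Acyclic T → Acyclic U
acyclic-⊆ {T = T} {U} U⊆T acyc u = acyc (U⊆T u) ∘ Star-map (del-mono {T = U} {T} U⊆T)

-- The walk is kept up to its first passage over `p q` and after its last one; if these two pieces
-- meet at the same end of the edge, they are joined up again.
star-del : {T : FinRel k} {a b : Fin k} (p q : Fin k) → Star T a b →
  Star (del T p q) a b
  ⊎ (Star (del T p q) a p × Star (del T p q) q b)
  ⊎ (Star (del T p q) a q × Star (del T p q) p b)
star-del p q ε = inj₁ ε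
star-del {a = a} p q (_◅_ {j = c} t ts) with same? a c p q | star-del p q ts
... | yes (inj₁ (refl , refl)) | inj₁ w              = inj₂ (inj₁ (ε , w))
... | yes (inj₁ (refl , refl)) | inj₂ (inj₁ (_ , w)) = inj₂ (inj₁ (ε , w))
... | yes (inj₁ (refl , refl)) | inj₂ (inj₂ (_ , w)) = inj₁ w
... | yes (inj₂ (refl , refl)) | inj₁ w              = inj₂ (inj₂ (ε , w))
... | yes (inj₂ (refl , refl)) | inj₂ (inj₁ (_ , w)) = inj₁ w
... | yes (inj₂ (refl , refl)) | inj₂ (inj₂ (_ , w)) = inj₂ (inj₂ (ε , w))
... | no ne | w = Sum.map ((t , ne) ◅_) (Sum.map (map₁ ((t , ne) ◅_)) (map₁ ((t , ne) ◅_))) w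

-- A cycle of `U` that uses `p q` leaves a path between `p` and `q` in `T`, and one that avoids
-- `p q` lies in `T`.
acyclic-addEdge : {T U : FinRel k} {p q : Fin k} → Symmetric T → Symmetric U →
  del U p q ⇒ T → Acyclic T → ¬ Star T p q → Acyclic U
acyclic-addEdge {T = T} {U} {p} {q} T-sym U-sym U⊆T acyc sep {a} {b} u w with same? a b p q
... | yes (inj₁ (refl , refl)) = sep (Star-map U⊆T w)
... | yes (inj₂ (refl , refl)) =
  sep (reverse T-sym (Star-map shrink w))
  where
  shrink : del U q p ⇒ T
  shrink (u , ne) = U⊆T (u , ne ∘ Sum.swap)
... | no ne with star-del p q w
...   | inj₁ w′ = acyc (U⊆T (u , ne)) (Star-map shrink w′)
  where
  shrink : del (del U a b) p q ⇒ del T a b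
  shrink ((u , x) , y) = U⊆T (u , y) , x
...   | inj₂ (inj₁ (w₁ , w₂)) =
  sep (reverse T-sym (Star-map shrink w₁) ◅◅ U⊆T (u , ne) ◅ reverse T-sym (Star-map shrink w₂))
  where
  shrink : del (del U a b) p q ⇒ T
  shrink ((u , x) , y) = U⊆T (u , y)
...   | inj₂ (inj₂ (w₁ , w₂)) =
  sep (Star-map shrink w₂ ◅◅ T-sym (U⊆T (u , ne)) ◅ Star-map shrink w₁)
  where
  shrink : del (del U a b) p q ⇒ T
  shrink ((u , x) , y) = U⊆T (u , y)

-- Colour classes and monochromatic cycles

ColourFn : ℕ → Set
ColourFn k = Fin k → Fin k → Bool

SymColour : ColourFn k → Set
SymColour c = ∀ i j → c i j ≡ c j i

Class : FinRel k → ColourFn k → Bool → FinRel k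
Class E c b x y = E x y × c x y ≡ b

class? : {E : FinRel k} → Decidable E → ∀ c b → Decidable (Class E c b)
class? E? c b x y = E? x y ×-dec c x y Bool.≟ b

class-sym : {E : FinRel k} → Symmetric E → ∀ {c} → SymColour c → ∀ {b} → Symmetric (Class E c b)
class-sym E-sym c-sym {x = x} {y} (e , p) = E-sym e , trans (c-sym y x) p

class-mono : {E F : FinRel k} {c : ColourFn k} {b : Bool} → E ⇒ F → Class E c b ⇒ Class F c b
class-mono E⊆F (e , p) = E⊆F e , p

Good : FinRel k → ColourFn k → Set
Good E c = ∀ b → Acyclic (Class E c b)

Colourable : FinRel k → Set
Colourable {k} E = Σ[ c ∈ ColourFn k ] SymColour c × Good E c

good-⊆ : {E F : FinRel k} {c : ColourFn k} → E ⇒ F → Good F c → Good E c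
good-⊆ {E = E} {F} {c} E⊆F good b =
  acyclic-⊆ {T = Class F c b} {Class E c b} (class-mono {E = E} {F} {c} E⊆F) (good b)

colourable-⊆ : {E F : FinRel k} → E ⇒ F → Colourable F → Colourable E
colourable-⊆ {E = E} {F} E⊆F (c , c-sym , good) = c , c-sym , good-⊆ {E = E} {F} {c} E⊆F good

same-injective : {f : Fin m → Fin k} → Injective _≡_ _≡_ f → ∀ {x y a b} →
  SameEdge (f x) (f y) (f a) (f b) → SameEdge x y a b
same-injective f-inj = Sum.map (λ (p , q) → f-inj p , f-inj q) (λ (p , q) → f-inj p , f-inj q)

good-pullback : {E : FinRel m} {F : FinRel k} {c : ColourFn k} (f : Fin m → Fin k) →
  Injective _≡_ _≡_ f → (∀ {i j} → E i j → F (f i) (f j)) →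
  Good F c → Good E (λ i j → c (f i) (f j))
good-pullback f f-inj hom good b (e , p) w =
  good b (hom e , p) (gmap f (λ ((e , p) , ne) → (hom e , p) , ne ∘ same-injective f-inj) w)

-- The closing edge would have to be a bridge, but the other edges of the cycle join its ends.
monoCycle⇒¬good : (G : Graph) (c : Colouring G) → MonoCycle G c → ¬ Good (Adj G) (col c)
monoCycle⇒¬good G c (m , v , v-inj , b , steps , closing) good =
  good b closing (reverse T-sym (chain (suc (suc m)) v λ i → steps i , new i))
  where
  T-sym : Symmetric (del (Class (Adj G) (col c) b) _ _)
  T-sym = del-sym {T = Class (Adj G) (col c) b} (class-sym {E = Adj G} (sym G) (colSym c))
  new : ∀ i → ¬ SameEdge (v (inject₁ i)) (v (suc i)) (v (fromℕ (suc (suc m)))) (v zero)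
  new i       (inj₁ (p , _)) = fromℕ≢inject₁ (≡-sym (v-inj p))
  -- A cycle has at least three vertices, so its first step does not end at the last vertex.
  new zero    (inj₂ (_ , q)) = contradiction (v-inj q) λ ()
  new (suc i) (inj₂ (p , _)) = contradiction (v-inj p) λ ()

-- The edge closes a simple path between its ends. Length zero would make it a loop, and length one
-- would be the deleted edge itself.
star⇒monoCycle : (G : Graph) (c : Colouring G) {a b : Fin (n G)} (h : Bool) →
  let T = Class (Adj G) (col c) h in T a b → Star (del T a b) a b → MonoCycle G c
star⇒monoCycle G c h t w with star⇒path w
... | simple zero          v v-inj refl refl s = ⊥-elim (irrefl G (proj₁ t))
... | simple (suc zero)    v v-inj refl refl s = contradiction (inj₁ (refl , refl)) (proj₂ (s zero))
... | simple (suc (suc m)) v v-inj refl refl s =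
  m , v , v-inj , h , proj₁ ∘ s , class-sym {E = Adj G} (sym G) (colSym c) t

Searchable : Set → Set₁
Searchable A = {P : A → Set} → (∀ a → Dec (P a)) → Dec (∃ P)

bool-searchable : Searchable Bool
bool-searchable P? = map′ Sum.[ (false ,_) , (true ,_) ]
  (λ { (false , p) → inj₁ p ; (true , p) → inj₂ p }) (P? false ⊎-dec P? true)

vec-searchable : {A : Set} → Searchable A → ∀ k → Searchable (Vec A k)
vec-searchable A-s zero    P? = map′ ([] ,_) (λ { ([] , p) → p }) (P? [])
vec-searchable A-s (suc k) P? = map′ (λ (a , v , p) → a ∷ᵛ v , p) (λ { (a ∷ᵛ v , p) → a , v , p })
  (A-s λ a → vec-searchable A-s k λ v → P? (a ∷ᵛ v))

-- Whether some edge fails to be a bridge in its colour is decided by search; if none fails, the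
-- colouring itself is good.
uncolourable⇒inR : (G : Graph) → Decidable (Adj G) → ¬ Colourable (Adj G) → InR G
uncolourable⇒inR G adj? unc c
  with bool-searchable (λ h → any? λ a → any? λ b →
         class? adj? (col c) h a b ×-dec star? (del? (class? adj? (col c) h) a b) a b)
... | yes (h , a , b , t , w) = star⇒monoCycle G c h t w
... | no  none = contradiction
  (col c , colSym c , λ h {a} {b} t w → none (h , a , b , t , w)) unc

inR⇒uncolourable : (G : Graph) → InR G → ¬ Colourable (Adj G)
inR⇒uncolourable G inR (c , c-sym , good) = monoCycle⇒¬good G c′ (inR c′) good
  where
  c′ : Colouring G
  c′ = record { col = c ; colSym = c-sym }

-- Membership in M(C)

-- Single edge deletions and the absence of isolated vertices account for all proper subgraphs.
-- Minimality is doubly negated because it is derived from `¬ InR` of a subgraph.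
record Critical (G : Graph) : Set where
  field
    adj?         : Decidable (Adj G)
    uncolourable : ¬ Colourable (Adj G)
    minimal      : ∀ {a b} → Adj G a b → ¬ ¬ Colourable (del (Adj G) a b)
    neighbour    : ∀ a → ∃[ b ] Adj G a b

¬¬-∀ : {P : Fin k → Set} → (∀ i → ¬ ¬ P i) → ¬ ¬ (∀ i → P i)
¬¬-∀ = sequence (RawMonad.rawApplicative ¬¬-Monad)

-- If `H` missed an edge of `G`, a splitting of `G` without that edge would pull back to `H`. So `H`
-- covers every edge, and every vertex because none is isolated.
critical⇒inM : (G : Graph) → Critical G → InM G
critical⇒inM G crit = uncolourable⇒inR G adj? uncolourable , minimality
  where
  open Critical crit
  minimality : (H : Graph) (s : Subgraph H G) → Proper s → ¬ InR H
  minimality H s proper inR-H =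
    ¬¬-∀ (λ a → ¬¬-∀ λ b → covered a b) λ cover → proper
      ( (λ a → let (i , _ , p , _) = cover a _ (proj₂ (neighbour a)) in
               i , λ { refl → p })
      , λ i j e → let (i′ , j′ , p , q , e′) = cover _ _ e in
                  subst₂ (Adj H) (embInj s p) (embInj s q) e′ )
    where
    Covered : Fin (n G) → Fin (n G) → Set
    Covered a b = ∃[ i ] ∃[ j ] emb s i ≡ a × emb s j ≡ b × Adj H i j
    covered : ∀ a b → ¬ ¬ (Adj G a b → Covered a b)
    covered a b ¬cov with adj? a b
    ... | no ¬e = ¬cov λ e → contradiction e ¬e
    ... | yes e = minimal e λ (c , c-sym , good) →
      inR⇒uncolourable H inR-H
        ( (λ i j → c (emb s i) (emb s j)) , (λ i j → c-sym _ _)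
        , good-pullback {E = Adj H} {del (Adj G) a b} {c} (emb s) (embInj s)
            (λ h → embAdj s h , λ
              { (inj₁ (p , q)) → ¬cov λ _ → _ , _ , p , q , h
              ; (inj₂ (p , q)) → ¬cov λ _ → _ , _ , q , p , sym H h })
            good )

module _ (G : Graph) (inR : InR G) where

  private
    -- Colourings as finite data, over which existence can be decided by search.
    Matrix : Set
    Matrix = Vec (Vec Bool (n G)) (n G)

    entry : Matrix → ColourFn (n G)
    entry M i j = lookup (lookup M i) j

    -- The conjunction makes any matrix symmetric and leaves symmetric ones as they are.
    fromMatrix : Matrix → Colouring G
    fromMatrix M = record
      { col = λ i j → entry M i j ∧ entry M j i ; colSym = λ i j → Bool.∧-comm (entry M i j) _ }

    toMatrix : Colouring G → Matrix
    toMatrix c = tabulate λ i → tabulate (col c i)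

    fromMatrix∘toMatrix : ∀ c i j → col (fromMatrix (toMatrix c)) i j ≡ col c i j
    fromMatrix∘toMatrix c i j = begin
      entry M i j ∧ entry M j i ≡⟨ cong₂ _∧_ (entry-toMatrix i j) (entry-toMatrix j i) ⟩
      col c i j ∧ col c j i     ≡⟨ cong (col c i j ∧_) (colSym c j i) ⟩
      col c i j ∧ col c i j     ≡⟨ Bool.∧-idem _ ⟩
      col c i j                 ∎
      where
      open ≡-Reasoning
      M = toMatrix c
      entry-toMatrix : ∀ i j → entry (toMatrix c) i j ≡ col c i j
      entry-toMatrix i j = trans (cong (λ r → lookup r j) (lookup∘tabulate _ i)) (lookup∘tabulate _ j)

    OnCycle : Matrix → Fin (n G) → Fin (n G) → Set
    OnCycle M i j with m , v , _ ← inR (fromMatrix M) =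
      (∃[ t ] SameEdge i j (v (inject₁ t)) (v (suc t))) ⊎ SameEdge i j (v (fromℕ (suc (suc m)))) (v zero)

    onCycle? : ∀ M i j → Dec (OnCycle M i j)
    onCycle? M i j = any? (λ t → same? i j _ _) ⊎-dec same? i j _ _

    onCycle-sym : ∀ M {i j} → OnCycle M i j → OnCycle M j i
    onCycle-sym M = Sum.map (map₂ same-swapˡ) same-swapˡ

    onCycle⇒adj : ∀ M {i j} → OnCycle M i j → Adj G i j
    onCycle⇒adj M o with inR (fromMatrix M) | o
    ... | m , v , _ , _ , steps , closing | inj₁ (t , inj₁ (refl , refl)) = proj₁ (steps t)
    ... | m , v , _ , _ , steps , closing | inj₁ (t , inj₂ (refl , refl)) = sym G (proj₁ (steps t))
    ... | m , v , _ , _ , steps , closing | inj₂ (inj₁ (refl , refl)) = proj₁ closing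
    ... | m , v , _ , _ , steps , closing | inj₂ (inj₂ (refl , refl)) = sym G (proj₁ closing)

  -- The union of the cycles that inR returns on the finitely many colourings.
  support : Graph
  support = record
    { n      = n G
    ; Adj    = λ i j → ∃[ M ] OnCycle M i j
    ; sym    = λ (M , o) → M , onCycle-sym M o
    ; irrefl = λ (M , o) → irrefl G (onCycle⇒adj M o)
    }

  support? : Decidable (Adj support)
  support? i j = vec-searchable (vec-searchable bool-searchable (n G)) (n G) λ M → onCycle? M i j

  support⊆ : Subgraph support G
  support⊆ = record { emb = id ; embInj = id ; embAdj = λ (M , o) → onCycle⇒adj M o }

  -- A colouring assigns colours to all pairs, so it is also one of `G`; the cycle that `inR`
  -- returns for its matrix lies in `support` by construction.
  support-inR : InR support
  support-inR c with inR (fromMatrix (toMatrix c′)) in eq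
    where c′ = record { col = col c ; colSym = colSym c }
  ... | l , v , v-inj , h , steps , closing = l , v , v-inj , h ,
    (λ i → (M , onStep i) , agree (proj₂ (steps i))) , (M , onClosing) , agree (proj₂ closing)
    where
    c′ : Colouring G
    c′ = record { col = col c ; colSym = colSym c }
    M = toMatrix c′
    onStep : ∀ i → OnCycle M (v (inject₁ i)) (v (suc i))
    onStep i rewrite eq = inj₁ (i , inj₁ (refl , refl))
    onClosing : OnCycle M (v (fromℕ (suc (suc l)))) (v zero)
    onClosing rewrite eq = inj₂ (inj₁ (refl , refl))
    agree : ∀ {i j} → col (fromMatrix M) i j ≡ h → col c i j ≡ h
    agree {i} {j} = trans (≡-sym (fromMatrix∘toMatrix c′ i j))

-- `support` has decidable adjacency and admits no good colouring, so by minimality it contains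
-- every edge of `G`.
inM⇒adj? : (G : Graph) → InM G → Decidable (Adj G)
inM⇒adj? G (inR , minimality) i j with support? G inR i j
... | yes o = yes (embAdj (support⊆ G inR) o)
... | no ¬o = no λ e → minimality (support G inR) (support⊆ G inR)
  (λ (_ , full) → ¬o (full i j e)) (support-inR G inR)

module _ {k : ℕ} (z : Fin (suc k)) where

  private
    extendBy : ColourFn k → (i j : Fin (suc k)) → Dec (z ≡ i) → Dec (z ≡ j) → Bool
    extendBy c i j (no z≢i) (no z≢j) = c (punchOut z≢i) (punchOut z≢j)
    -- An arbitrary colour: the extension is applied where `z` is isolated.
    extendBy c i j _        _        = true

  extendColour : ColourFn k → ColourFn (suc k)
  extendColour c i j = extendBy c i j (z ≟ i) (z ≟ j)

  extendColour-sym : ∀ {c} → SymColour c → SymColour (extendColour c)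
  extendColour-sym c-sym i j with z ≟ i | z ≟ j
  ... | no _  | no _  = c-sym _ _
  ... | no _  | yes _ = refl
  ... | yes _ | no _  = refl
  ... | yes _ | yes _ = refl

  extendColour-≢ : ∀ {c i j} (z≢i : z ≢ i) (z≢j : z ≢ j) →
                   extendColour c i j ≡ c (punchOut z≢i) (punchOut z≢j)
  extendColour-≢ {c} {i} {j} z≢i z≢j with z ≟ i | z ≟ j
  ... | no _  | no _  = cong₂ c (punchOut-cong z refl) (punchOut-cong z refl)
  ... | no _  | yes p = contradiction p z≢j
  ... | yes p | _     = contradiction p z≢i

deleteVertex : ∀ {k} (E : FinRel (suc k)) → Symmetric E → (∀ {i} → ¬ E i i) → Fin (suc k) → Graph
deleteVertex {k} E E-sym E-irr z = record
  { n = k ; Adj = λ i j → E (punchIn z i) (punchIn z j) ; sym = E-sym ; irrefl = E-irr }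

-- No cycle passes through an isolated vertex, so removing it would leave a proper subgraph that
-- still satisfies `InR`.
inM⇒neighbour : (G : Graph) → InM G → ∀ a → ¬ (∀ b → ¬ Adj G a b)
inM⇒neighbour record { n = suc k ; Adj = E ; sym = E-sym ; irrefl = E-irr } (inR , minimality) z isolated =
  minimality H (record { emb = punchIn z ; embInj = punchIn-injective z _ _ ; embAdj = id })
    (λ (surj , _) → punchInᵢ≢i z _ (proj₂ (surj z) refl)) inR-H
  where
  H = deleteVertex E E-sym E-irr z
  inR-H : InR H
  inR-H c with inR (record { col = extendColour z (col c) ; colSym = extendColour-sym z (colSym c) })
  ... | m , v , v-inj , h , steps , closing =
    m , (λ i → punchOut (z≢v i)) , (λ {i} {j} p → v-inj (punchOut-injective (z≢v i) (z≢v j) p)) , h ,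
    (λ i → back (z≢v (inject₁ i)) (z≢v (suc i)) (steps i)) ,
    back (z≢v (fromℕ (suc (suc m)))) (z≢v zero) closing
    where
    z≢v : ∀ i → z ≢ v i
    z≢v zero    refl = isolated _ (proj₁ (steps zero))
    z≢v (suc i) refl = isolated _ (E-sym (proj₁ (steps i)))
    back : ∀ {i j} (z≢i : z ≢ i) (z≢j : z ≢ j) → E i j × extendColour z (col c) i j ≡ h →
           Adj H (punchOut z≢i) (punchOut z≢j) × col c (punchOut z≢i) (punchOut z≢j) ≡ h
    back z≢i z≢j (e , p) =
      subst₂ E (≡-sym (punchIn-punchOut z≢i)) (≡-sym (punchIn-punchOut z≢j)) e ,
      trans (≡-sym (extendColour-≢ z z≢i z≢j)) p

inM⇒critical : (G : Graph) → InM G → Critical G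
inM⇒critical G inM@(inR , minimality) = record
  { adj?         = adj?
  ; uncolourable = inR⇒uncolourable G inR
  ; minimal      = λ {a} {b} e unc →
      minimality (deleteEdge G a b) (record { emb = id ; embInj = id ; embAdj = proj₁ })
        (λ (_ , full) → proj₂ (full a b e) (inj₁ (refl , refl)))
        (uncolourable⇒inR (deleteEdge G a b) (del? adj? a b) unc)
  ; neighbour    = λ a → decidable-stable (any? (adj? a)) λ none →
      inM⇒neighbour G inM a λ b e → none (b , e)
  }
  where
  adj? = inM⇒adj? G inM

-- Both classes of G - e are spanning trees

recolour : ColourFn k → Fin k → Fin k → Bool → ColourFn k
recolour c p q b x y = if does (same? x y p q) then b else c x y

recolour-same : ∀ (c : ColourFn k) {p q} b {x y} → SameEdge x y p q → recolour c p q b x y ≡ b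
recolour-same c {p} {q} b {x} {y} s rewrite dec-true (same? x y p q) s = refl

recolour-other : ∀ (c : ColourFn k) {p q} b {x y} → ¬ SameEdge x y p q → recolour c p q b x y ≡ c x y
recolour-other c {p} {q} b {x} {y} ne rewrite dec-false (same? x y p q) ne = refl

recolour-sym : {c : ColourFn k} → SymColour c → ∀ p q b → SymColour (recolour c p q b)
recolour-sym {c = c} c-sym p q b x y with same? x y p q
... | yes s = trans (recolour-same c b s) (≡-sym (recolour-same c b (same-swapˡ s)))
... | no ne = trans (recolour-other c b ne)
                (trans (c-sym x y) (≡-sym (recolour-other c b (ne ∘ same-swapˡ))))

-- Class `b` gains an edge between two of its components; the other class gains none.
good-recolour : {E : FinRel k} {c : ColourFn k} {p q : Fin k} (b : Bool) →
  Symmetric E → SymColour c → Good (del E p q) c → ¬ Star (Class (del E p q) c b) p q →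
  Good E (recolour c p q b)
good-recolour {k} {E} {c} {p} {q} b E-sym c-sym good sep h with h Bool.≟ b
... | yes refl = acyclic-addEdge
  (class-sym {E = del E p q} (del-sym {T = E} E-sym) c-sym)
  (class-sym {E = E} E-sym (recolour-sym c-sym p q b))
  (λ ((e , r) , ne) → (e , ne) , trans (≡-sym (recolour-other c b ne)) r)
  (good b) sep
... | no h≢b = acyclic-⊆ {T = Class (del E p q) c h} other (good h)
  where
  other : Class E (recolour c p q b) h ⇒ Class (del E p q) c h
  other {x} {y} (e , r) = (e , ne) , trans (≡-sym (recolour-other c b ne)) r
    where
    ne : ¬ SameEdge x y p q
    ne s = h≢b (trans (≡-sym r) (recolour-same c b s))

module Spanning {G : Graph} (crit : Critical G) {p₀ q₀ : Fin (n G)} (e₀ : Adj G p₀ q₀)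
                {c₀ : ColourFn (n G)} (c₀-sym : SymColour c₀) (good₀ : Good (del (Adj G) p₀ q₀) c₀)
  where

  open Critical crit

  private
    V = Fin (n G)
    E = Adj G

    Rest : ColourFn (n G) → V → V → Bool → FinRel (n G)
    Rest c p q = Class (del E p q) c

    rest-sym : ∀ {c} → SymColour c → ∀ {p q b} → Symmetric (Rest c p q b)
    rest-sym c-sym {p} {q} = class-sym {E = del E p q} (del-sym {T = E} (sym G)) c-sym

    rest? : ∀ c p q b → Decidable (Rest c p q b)
    rest? c p q = class? (del? adj? p q) c

    Within : FinRel (n G) → FinRel (n G) → FinRel (n G)
    Within S T x y = T x y × S x y

  -- Recolouring S by a good colouring c′ keeps all other edges bridges, because in c₀ every edge
  -- of S can be replaced by a path inside S.  So S is uncolourable, hence not a proper part of E.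
  spanned⇒full : {S : FinRel (n G)} → Decidable S → Symmetric S → S p₀ q₀ →
    (∀ {x y} → S x y → ∀ b → Star (Within S (Rest c₀ p₀ q₀ b)) x y) →
    ∀ {x y} → E x y → S x y
  spanned⇒full {S} S? S-sym s₀ spanned {x₀} {y₀} e = decidable-stable (S? x₀ y₀) λ ¬s →
    minimal e λ (c′ , c′-sym , good′) → uncolourable (combine ¬s c′ c′-sym good′)
    where
    combine : ¬ S x₀ y₀ → ∀ c′ → SymColour c′ → Good (del E x₀ y₀) c′ → Colourable E
    combine ¬s c′ c′-sym good′ = d , d-sym , d-good
      where
      d : ColourFn (n G)
      d i j = if does (S? i j) then c′ i j else c₀ i j
      d-in : ∀ {i j} → S i j → d i j ≡ c′ i j
      d-in {i} {j} s rewrite dec-true (S? i j) s = refl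
      d-out : ∀ {i j} → ¬ S i j → d i j ≡ c₀ i j
      d-out {i} {j} ¬s rewrite dec-false (S? i j) ¬s = refl
      d-sym : SymColour d
      d-sym i j with S? i j
      ... | yes s = trans (c′-sym i j) (≡-sym (d-in (S-sym s)))
      ... | no ¬s = trans (c₀-sym i j) (≡-sym (d-out (¬s ∘ S-sym)))
      T : Bool → FinRel (n G)
      T = Class E d
      T-sym : ∀ {b} → Symmetric (T b)
      T-sym = class-sym {E = E} (sym G) d-sym
      outside : ∀ {b i j} → T b i j → ¬ S i j → Rest c₀ p₀ q₀ b i j
      outside (e , r) ¬s =
        (e , λ { (inj₁ (refl , refl)) → ¬s s₀ ; (inj₂ (refl , refl)) → ¬s (S-sym s₀) }) ,
        trans (≡-sym (d-out ¬s)) r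
      bridge : ∀ {b r s} → T b r s → ¬ S r s → ¬ Star (del (T b) r s) r s
      bridge {b} {r} {s} t ¬s w = good₀ b (outside t ¬s) ((reroute ⋆) w)
        where
        reroute : del (T b) r s ⇒ Star (del (Rest c₀ p₀ q₀ b) r s)
        reroute {i} {j} (t′ , ne) with toSum (S? i j)
        ... | inj₂ ¬s′ = return (outside t′ ¬s′ , ne)
        ... | inj₁ s′ = Star-map
          (λ (u , s″) → u , λ { (inj₁ (refl , refl)) → ¬s s″ ; (inj₂ (refl , refl)) → ¬s (S-sym s″) })
          (spanned s′ b)
      d-good : Good E d
      d-good b {i} {j} t w with toSum (S? i j)
      ... | inj₂ ¬s′ = bridge t ¬s′ w
      ... | inj₁ s′ = good′ b (inside t s′) (Star-map collapse (simple-edges w))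
        where
        inside : ∀ {i j} → T b i j → S i j → Class (del E x₀ y₀) c′ b i j
        inside (e , r) s =
          (e , λ { (inj₁ (refl , refl)) → ¬s s ; (inj₂ (refl , refl)) → ¬s (S-sym s) }) ,
          trans (≡-sym (d-in s)) r
        -- On a cycle through an edge of `S`, an edge `r s` outside `S` would be bypassed by the
        -- rest of the cycle, against `bridge`. So the whole cycle lies in `S`, where `c′` is good.
        collapse : ∀ {r s} → del (T b) i j r s × Star (del (del (T b) i j) r s) i r
                     × Star (del (del (T b) i j) r s) s j →
                   del (Class (del E x₀ y₀) c′ b) i j r s
        collapse {r} {s} ((t′ , ne) , w₁ , w₂) with toSum (S? r s)
        ... | inj₁ s″ = inside t′ s″ , ne
        ... | inj₂ ¬s″ = contradiction around (bridge t′ ¬s″)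
          where
          drop : del (del (T b) i j) r s ⇒ del (T b) r s
          drop = map₁ proj₁
          back : Symmetric (del (T b) r s)
          back = del-sym {T = T b} T-sym
          around : Star (del (T b) r s) r s
          around = reverse back (Star-map drop w₁) ◅◅ (t , ne ∘ same-sym)
                   ◅ reverse back (Star-map drop w₂)

  -- Reach c p q: starting from c₀, exchanges lead to the colouring c with p q as uncoloured edge.
  -- An exchange gives p q the colour b and uncolours an edge of the path of colour b from p to q.
  data Reach : ColourFn (n G) → V → V → Set where
    start    : Reach c₀ p₀ q₀
    flip     : ∀ {c p q} → Reach c p q → Reach c q p
    exchange : ∀ {c p q} → Reach c p q → ∀ b {r s} → Rest c p q b r s →
               ¬ Star (del (Rest c p q b) r s) p q → Reach (recolour c p q b) r s

  Reachable : FinRel (n G)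
  Reachable p q = ∃[ c ] Reach c p q

  private
    reachable-sym : Symmetric Reachable
    reachable-sym (c , r) = c , flip r

    reach-sound : ∀ {c p q} → Reach c p q → E p q × SymColour c × Good (del E p q) c
    reach-sound start = e₀ , c₀-sym , good₀
    reach-sound (flip r) with e , c-sym , good ← reach-sound r =
      sym G e , c-sym , good-⊆ {E = del E _ _} {del E _ _} (λ (e , ne) → e , ne ∘ Sum.swap) good
    reach-sound (exchange {c} {p} {q} r b {r′} {s′} t sep) with e , c-sym , good ← reach-sound r =
      proj₁ (proj₁ t) , recolour-sym c-sym p q b ,
      good-recolour {E = del E r′ s′} b (del-sym {T = E} (sym G)) c-sym
        (good-⊆ {E = del (del E r′ s′) p q} {del E p q} (map₁ proj₁) good)
        (sep ∘ Star-map λ (((e , ne) , ne′) , x) → ((e , ne′) , x) , ne)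

    -- Without a path of colour `b`, giving `p q` that colour would split all of `G`. Each edge of
    -- the path can be exchanged for `p q`, so it is reachable in turn.
    reach-connects : ∀ {c p q} → Reach c p q → ∀ b →
                     Star (Within Reachable (Rest c p q b)) p q
    reach-connects {c} {p} {q} r b with reach-sound r
    ... | e , c-sym , good = Star-map on-path (simple-edges connected)
      where
      connected : Star (Rest c p q b) p q
      connected = decidable-stable (star? (rest? c p q b) p q) λ sep → uncolourable
        (recolour c p q b , recolour-sym c-sym p q b , good-recolour {E = E} b (sym G) c-sym good sep)
      on-path : ∀ {r s} → Rest c p q b r s × Star (del (Rest c p q b) r s) p r
                  × Star (del (Rest c p q b) r s) s q → Within Reachable (Rest c p q b) r s
      -- A path `w` that still joined `p` and `q` would combine with `w₁` and `w₂` to bypass the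
      -- edge `t`.
      on-path {r′} {s′} (t , w₁ , w₂) = t , _ , exchange r b t λ w →
        good b t (reverse back w₁ ◅◅ w ◅◅ reverse back w₂)
        where
        back : Symmetric (del (Rest c p q b) r′ s′)
        back = del-sym {T = Rest c p q b} (rest-sym c-sym)

    within-sym : ∀ {c} → SymColour c → ∀ {p q b} → Symmetric (Within Reachable (Rest c p q b))
    within-sym c-sym (t , s) = rest-sym c-sym t , reachable-sym s

    -- The exchanges are undone one by one: an edge of the class after an exchange either was there
    -- before or is the newly coloured `p q`, whose ends were already joined by a path of that
    -- colour.
    reach-span : ∀ {c p q} → Reach c p q → ∀ {b} →
      Within Reachable (Rest c p q b) ⇒ Star (Within Reachable (Rest c₀ p₀ q₀ b))
    reach-span start t = return t
    reach-span (flip r) (((e , ne) , x) , s) = reach-span r (((e , ne ∘ Sum.swap) , x) , s)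
    reach-span (exchange {c} {p} {q} r b t sep) {h} {x} {y} (((e , _) , z) , s) with same? x y p q
    ... | no ne = reach-span r (((e , ne) , trans (≡-sym (recolour-other c b ne)) z) , s)
    ... | yes same with trans (≡-sym (recolour-same c b same)) z
    ...   | refl with same | (reach-span r ⋆) (reach-connects r b)
    ...     | inj₁ (refl , refl) | w = w
    ...     | inj₂ (refl , refl) | w = reverse (within-sym c₀-sym) w

  reachable-spanned : ∀ {x y} → Reachable x y → ∀ b →
                      Star (Within Reachable (Rest c₀ p₀ q₀ b)) x y
  reachable-spanned (c , r) b = (reach-span r ⋆) (reach-connects r b)

  adjacent-connected : ∀ {x y} → E x y → ∀ b → Star (Rest c₀ p₀ q₀ b) x y
  adjacent-connected {x} {y} e b = decidable-stable (star? (rest? c₀ p₀ q₀ b) x y) λ ¬w →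
    -- `Reachable` comes without a decision procedure, but it may be assumed decided since the goal
    -- is `⊥`.
    ¬¬-∀ (λ i → ¬¬-∀ λ j → ¬¬-excluded-middle) λ S? →
    ¬w (Star-map proj₁ (reachable-spanned
      (spanned⇒full S? reachable-sym (c₀ , start) reachable-spanned e) b))

  -- Neighbours are connected in both classes, so the component of `p₀` in class `b` is closed under
  -- adjacency. Its edges form a set to which `spanned⇒full` applies again; hence they are all
  -- edges, and every vertex lies on one.
  spanning : ∀ b x y → Star (Rest c₀ p₀ q₀ b) x y
  spanning b x y = reverse (rest-sym c₀-sym) (from-p₀ x) ◅◅ from-p₀ y
    where
    A : V → Set
    A = Star (Rest c₀ p₀ q₀ b) p₀
    A? : ∀ x → Dec (A x)
    A? = star? (rest? c₀ p₀ q₀ b) p₀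
    S : FinRel (n G)
    S x y = E x y × A x
    S-sym : Symmetric S
    S-sym (e , a) = sym G e , a ◅◅ adjacent-connected e b
    stay : ∀ {h x y} → A x → Star (Rest c₀ p₀ q₀ h) x y → Star (Within S (Rest c₀ p₀ q₀ h)) x y
    stay a ε = ε
    stay a (t ◅ ts) = (t , proj₁ (proj₁ t) , a) ◅ stay (a ◅◅ adjacent-connected (proj₁ (proj₁ t)) b) ts
    from-p₀ : ∀ x → A x
    from-p₀ x = proj₂ (spanned⇒full (λ x y → adj? x y ×-dec A? x) S-sym (e₀ , ε)
      (λ (e , a) h → stay a (adjacent-connected e h)) (proj₂ (neighbour x)))

-- Adding a vertex

Old : FinRel (suc k) → FinRel k
Old T i j = T (suc i) (suc j)

-- Walks are cut at their first and last visits to the new vertex `zero`; the outer pieces run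
-- through old vertices.
star-from-new : {T : FinRel (suc k)} {b : Fin k} → Star T zero (suc b) →
                ∃[ s ] T zero (suc s) × Star (Old T) s b
star-from-old : {T : FinRel (suc k)} {a b : Fin k} → Star T (suc a) (suc b) →
                Star (Old T) a b ⊎ (∃[ r ] ∃[ s ] T (suc r) zero × T zero (suc s)
                                      × Star (Old T) a r × Star (Old T) s b)
star-from-new (_◅_ {j = zero} t ts)  = star-from-new ts
star-from-new (_◅_ {j = suc c} t ts) with star-from-old ts
... | inj₁ w                     = c , t , w
... | inj₂ (_ , s , _ , u , _ , w) = s , u , w
star-from-old ε = inj₁ ε
star-from-old (_◅_ {j = zero} t ts) with s , u , w ← star-from-new ts = inj₂ (_ , s , t , u , ε , w)
star-from-old (_◅_ {j = suc c} t ts) =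
  Sum.map (t ◅_) (λ (r , s , x , y , w , z) → r , s , x , y , t ◅ w , z) (star-from-old ts)

-- A cycle through the new vertex enters and leaves it by two neighbours that are then connected
-- through old vertices.
acyclic-addVertex : {T : FinRel (suc k)} → Symmetric T → ¬ T zero zero → Acyclic (Old T) →
  (∀ {a b} → T zero (suc a) → T zero (suc b) → a ≢ b → ¬ Star (Old T) a b) → Acyclic T
acyclic-addVertex {k} {T} T-sym irr acyc sep = go
  where
  from-new : ∀ {a} → T zero (suc a) → ¬ Star (del T zero (suc a)) zero (suc a)
  from-new t w with s , (u , ne) , w′ ← star-from-new w =
    sep u t (λ { refl → ne (inj₁ (refl , refl)) }) (Star-map proj₁ w′)
  go : Acyclic T
  go {zero}  {zero}  t w = irr t
  go {zero}  {suc a} t w = from-new t w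
  go {suc a} {zero}  t w = from-new (T-sym t) (reverse (λ (t , ne) → T-sym t , ne ∘ same-swapˡ ∘ Sum.swap) w)
  go {suc a} {suc b} t w with star-from-old w
  ... | inj₁ w′ = acyc t (Star-map shrink w′)
    where
    shrink : Old (del T (suc a) (suc b)) ⇒ del (Old T) a b
    shrink (t , ne) = t , ne ∘ same-cong suc
  ... | inj₂ (r , s , (x , _) , (y , _) , w₁ , w₂) with r ≟ s
  -- The two old pieces meet at `r`, so the excursion through the new vertex is cut out.
  ...   | yes refl = acyc t (Star-map shrink (w₁ ◅◅ w₂))
    where
    shrink : Old (del T (suc a) (suc b)) ⇒ del (Old T) a b
    shrink (t , ne) = t , ne ∘ same-cong suc
  ...   | no r≢s = sep (T-sym x) y r≢s (back (Star-map proj₁ w₁) ◅◅ t ◅ back (Star-map proj₁ w₂))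
    where
    back : ∀ {i j} → Star (Old T) i j → Star (Old T) j i
    back = reverse T-sym

paint : ColourFn k → (Fin k → Bool) → ColourFn (suc k)
paint c g zero    zero    = true
paint c g zero    (suc j) = g j
paint c g (suc i) zero    = g i
paint c g (suc i) (suc j) = c i j

paint-sym : {c : ColourFn k} → SymColour c → ∀ g → SymColour (paint c g)
paint-sym c-sym g zero    zero    = refl
paint-sym c-sym g zero    (suc j) = refl
paint-sym c-sym g (suc i) zero    = refl
paint-sym c-sym g (suc i) (suc j) = c-sym i j

module _ {F : FinRel (suc k)} (F-sym : Symmetric F) (irr : ¬ F zero zero) where

  good-paint : ∀ {c} → SymColour c → Good (Old F) c → (g : Fin k → Bool) →
    (∀ {h a b} → F zero (suc a) → F zero (suc b) → a ≢ b → g a ≡ h → g b ≡ h →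
      ¬ Star (Class (Old F) c h) a b) →
    Good F (paint c g)
  good-paint c-sym good g sep h = acyclic-addVertex
    (class-sym {E = F} F-sym (paint-sym c-sym g)) (irr ∘ proj₁) (good h)
    λ (x , p) (y , q) a≢b → sep x y a≢b p q

  private
    endpoint-unique : ∀ {p q} {a b : Fin k} {h} → a ≡ p ⊎ a ≡ q → b ≡ p ⊎ b ≡ q →
                      does (a ≟ p) ≡ h → does (b ≟ p) ≡ h → a ≡ b
    endpoint-unique {p} {q} {a} {b} A B x y with a ≟ p | b ≟ p
    ... | yes refl | yes refl = refl
    ... | yes _    | no _     = contradiction (trans x (≡-sym y)) λ ()
    ... | no _     | yes _    = contradiction (trans x (≡-sym y)) λ ()
    ... | no a≢p | no b≢p with A | B
    ...   | inj₁ r    | _         = contradiction r a≢p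
    ...   | inj₂ _    | inj₁ r    = contradiction r b≢p
    ...   | inj₂ refl | inj₂ refl = refl

  -- The edges to `p` and `q` get different colours, so the new vertex has at most one edge in each
  -- class.
  colourable-twoNeighbours : ∀ p q → (∀ {a} → F zero (suc a) → a ≡ p ⊎ a ≡ q) →
    Colourable (Old F) → Colourable F
  colourable-twoNeighbours p q nbrs (c , c-sym , good) =
    paint c g , paint-sym c-sym g , good-paint c-sym good g
      λ x y a≢b r s _ → a≢b (endpoint-unique (nbrs x) (nbrs y) r s)
    where
    g = λ j → does (j ≟ p)

  -- Two edges of one colour at the new vertex would close a cycle with a path of that colour
  -- between their old ends.
  new-edges-differ : ∀ {c} → SymColour c → Good F c → ∀ {a b} → a ≢ b → F zero (suc a) → F zero (suc b) →
    (∀ h → Star (Class (Old F) (λ i j → c (suc i) (suc j)) h) b a) → c zero (suc a) ≢ c zero (suc b)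
  new-edges-differ {c} c-sym good {a} {b} a≢b x y w p =
    good (c zero (suc b)) (x , p) (((y , refl) , ne) ◅ gmap suc (λ t → t , ne′) (w _))
    where
    ne : ¬ SameEdge zero (suc b) zero (suc a)
    ne (inj₁ (_ , r)) = a≢b (≡-sym (suc-injective r))
    ne′ : ∀ {i j} → ¬ SameEdge (suc i) (suc j) zero (suc a)
    ne′ (inj₁ (() , _))
    ne′ (inj₂ (_ , ()))

pigeonhole₃ : (a b c : Bool) → a ≢ b → b ≢ c → a ≢ c → ⊥
pigeonhole₃ false false _     p q r = p refl
pigeonhole₃ true  true  _     p q r = p refl
pigeonhole₃ false true  true  p q r = q refl
pigeonhole₃ true  false false p q r = q refl
pigeonhole₃ false true  false p q r = r refl
pigeonhole₃ true  false true  p q r = r refl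

-- The three constructions

Spans : FinRel k → Set
Spans F = ∀ {c} → SymColour c → Good F c → ∀ b x y → Star (Class F c b) x y

addVertex? : (G : Graph) {N : Fin (n G) → Set} → Decidable (Adj G) → (∀ j → Dec (N j)) →
             Decidable (Adj (addVertex G N))
addVertex? G adj? N? zero    zero    = no λ ()
addVertex? G adj? N? zero    (suc j) = N? j
addVertex? G adj? N? (suc i) zero    = N? i
addVertex? G adj? N? (suc i) (suc j) = adj? i j

module Con1 (K : Graph) (u v w : Fin (n K)) (u≢v : u ≢ v) (u≢w : u ≢ w) (e : Adj K v w) where

  private
    F = Adj (con1 K u v w)

    F-sym : Symmetric F
    F-sym {i} {j} = sym (con1 K u v w) {i} {j}

    v≢w : v ≢ w
    v≢w refl = irrefl K e

    new : ∀ {a} → a ≡ u ⊎ a ≡ v ⊎ a ≡ w → F zero (suc a)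
    new N = N , λ { (inj₁ (() , _)) ; (inj₂ (() , _)) }

    oldF : Old F ⇒ del (Adj K) v w
    oldF (t , ne) = t , ne ∘ same-cong suc

    Fold : del (Adj K) v w ⇒ Old F
    Fold (t , ne) = t , ne ∘ same-injective suc-injective

  con1-uncolourable : Spans (del (Adj K) v w) → ¬ Colourable F
  con1-uncolourable spans (c , c-sym , good) = pigeonhole₃ _ _ _
    (differ u≢v (new (inj₁ refl)) (new (inj₂ (inj₁ refl))))
    (differ v≢w (new (inj₂ (inj₁ refl))) (new (inj₂ (inj₂ refl))))
    (differ u≢w (new (inj₁ refl)) (new (inj₂ (inj₂ refl))))
    where
    good° : Good (del (Adj K) v w) (λ i j → c (suc i) (suc j))
    good° = good-pullback {F = F} suc suc-injective Fold good
    differ : ∀ {a b} → a ≢ b → F zero (suc a) → F zero (suc b) → c zero (suc a) ≢ c zero (suc b)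
    differ {a} {b} a≢b x y = new-edges-differ {F = F} F-sym (irrefl (con1 K u v w) {zero}) c-sym good a≢b x y
      λ h → Star-map (λ (t , r) → Fold t , r) (spans (λ i j → c-sym _ _) good° h b a)

  -- At most two neighbours of the new vertex remain, and their edges can be given different
  -- colours.
  colourable-withoutNewEdge : Colourable (del (Adj K) v w) → ∀ {a} → F zero (suc a) →
                              Colourable (del F zero (suc a))
  colourable-withoutNewEdge col (N , _) with others N
    where
    others : ∀ {a} → a ≡ u ⊎ a ≡ v ⊎ a ≡ w →
      ∃[ p ] ∃[ q ] (∀ {j} → (j ≡ u ⊎ j ≡ v ⊎ j ≡ w) → j ≢ a → j ≡ p ⊎ j ≡ q)
    others (inj₁ refl)        = v , w , Sum.[ (λ p ne → contradiction p ne) , (λ r _ → r) ]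
    others (inj₂ (inj₁ refl)) = u , w , Sum.[ (λ p _ → inj₁ p) ,
                                  Sum.[ (λ p ne → contradiction p ne) , (λ r _ → inj₂ r) ] ]
    others (inj₂ (inj₂ refl)) = u , v , Sum.[ (λ p _ → inj₁ p) ,
                                  Sum.[ (λ r _ → inj₂ r) , (λ p ne → contradiction p ne) ] ]
  ... | p , q , rest = colourable-twoNeighbours
    (λ {i} {j} → del-sym {T = F} (λ {i} {j} → F-sym {i} {j}) {x = i} {j})
    (irrefl (con1 K u v w) {zero} ∘ proj₁) p q
    (λ ((N , _) , ne) → rest N λ { refl → ne (inj₁ (refl , refl)) })
    (colourable-⊆ (oldF ∘ proj₁) col)

  -- The colour of v w goes to the path v x w that replaces it, the other colour to x u.
  colourable-withoutOldEdge : ∀ {a b} → Old F a b → Colourable (del (Adj K) a b) →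
                              Colourable (del F (suc a) (suc b))
  colourable-withoutOldEdge {a} {b} f (c , c-sym , good) =
    paint c g , paint-sym c-sym g ,
    good-paint (λ {i} {j} → F′-sym {i} {j}) (irrefl (con1 K u v w) {zero} ∘ proj₁) c-sym
      (good-⊆ {E = Old F′} {del (Adj K) a b} (proj₁ ∘ shrink) good) g
      λ x y → sep (proj₁ (proj₁ x)) (proj₁ (proj₁ y))
    where
    F′ = del F (suc a) (suc b)
    F′-sym : Symmetric F′
    F′-sym {i} {j} = del-sym {T = F} (λ {i} {j} → F-sym {i} {j}) {x = i} {j}
    shrink : Old F′ ⇒ del (del (Adj K) a b) v w
    shrink (f , ne) with t , ne′ ← oldF f =
      (t , ne ∘ same-cong suc) , ne′
    g : Fin (n K) → Bool
    g j = if does (j ≟ u) then not (c v w) else c v w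
    g-u : g u ≡ not (c v w)
    g-u rewrite dec-true (u ≟ u) refl = refl
    g-other : ∀ {j} → u ≢ j → g j ≡ c v w
    g-other {j} u≢j rewrite dec-false (j ≟ u) (≢-sym u≢j) = refl
    vw-survives : Class (del (Adj K) a b) c (c v w) v w
    vw-survives = (e , λ s → proj₂ (oldF f) (same-sym s)) , refl
    -- The edge `v w` still has its colour in `c` and is a bridge there; `F′` lacks it, so its ends
    -- are apart.
    sep-vw : ¬ Star (Class (Old F′) c (c v w)) v w
    sep-vw st = good (c v w) vw-survives
      (Star-map (λ (f , r) → ((proj₁ (shrink f)) , r) , proj₂ (shrink f)) st)
    class-symF′ : ∀ {h} → Symmetric (Class (Old F′) c h)
    class-symF′ = class-sym {E = Old F′} (λ {i} {j} → F′-sym {suc i} {suc j}) c-sym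
    clash : ∀ {h j} → u ≢ j → g u ≡ h → g j ≡ h → ⊥
    clash u≢j p q = Bool.not-¬ refl (trans (≡-sym (g-other u≢j)) (trans q (trans (≡-sym p) g-u)))
    sep : ∀ {h i j} → i ≡ u ⊎ i ≡ v ⊎ i ≡ w → j ≡ u ⊎ j ≡ v ⊎ j ≡ w → i ≢ j → g i ≡ h → g j ≡ h →
          ¬ Star (Class (Old F′) c h) i j
    sep (inj₁ refl) (inj₁ refl)        ne p q = contradiction refl ne
    sep (inj₁ refl) (inj₂ (inj₁ refl)) ne p q = ⊥-elim (clash u≢v p q)
    sep (inj₁ refl) (inj₂ (inj₂ refl)) ne p q = ⊥-elim (clash u≢w p q)
    sep (inj₂ (inj₁ refl)) (inj₁ refl) ne p q = ⊥-elim (clash u≢v q p)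
    sep (inj₂ (inj₂ refl)) (inj₁ refl) ne p q = ⊥-elim (clash u≢w q p)
    sep (inj₂ (inj₁ refl)) (inj₂ (inj₁ refl)) ne p q = contradiction refl ne
    sep (inj₂ (inj₂ refl)) (inj₂ (inj₂ refl)) ne p q = contradiction refl ne
    sep (inj₂ (inj₁ refl)) (inj₂ (inj₂ refl)) ne refl q st
      rewrite g-other u≢v = sep-vw st
    sep (inj₂ (inj₂ refl)) (inj₂ (inj₁ refl)) ne refl q st
      rewrite g-other u≢w = sep-vw (reverse (λ {i} {j} → class-symF′ {x = i} {j}) st)

  con1-neighbour : (∀ a → ∃[ b ] Adj K a b) → ∀ a → ∃[ b ] F a b
  con1-neighbour nbr zero    = suc u , new (inj₁ refl)
  con1-neighbour nbr (suc a) with a ≟ v | a ≟ w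
  ... | yes refl | _        = zero , F-sym {zero} {suc a} (new (inj₂ (inj₁ refl)))
  ... | no _     | yes refl = zero , F-sym {zero} {suc a} (new (inj₂ (inj₂ refl)))
  ... | no a≢v   | no a≢w   with b , t ← nbr a =
    suc b , Fold (t , λ { (inj₁ (p , _)) → a≢v p ; (inj₂ (p , _)) → a≢w p })

  -- In construction (2) `K` is `G` with an added vertex of degree two, which is not critical; hence
  -- these hypotheses in place of `Critical K`.
  con1-critical : Decidable (Adj K) → (∀ a → ∃[ b ] Adj K a b) → Spans (del (Adj K) v w) →
    ¬ ¬ Colourable (del (Adj K) v w) →
    (∀ {a b} → Old F a b → ¬ ¬ Colourable (del F (suc a) (suc b))) → Critical (con1 K u v w)
  con1-critical adj? nbr spans col old = record
    { adj?         = del? (addVertex? K adj? λ j → j ≟ u ⊎-dec j ≟ v ⊎-dec j ≟ w) (suc v) (suc w)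
    ; uncolourable = con1-uncolourable spans
    ; minimal      = λ {a} {b} → minimal a b
    ; neighbour    = con1-neighbour nbr
    }
    where
    minimal : ∀ a b → F a b → ¬ ¬ Colourable (del F a b)
    minimal zero    zero    (() , _)
    minimal zero    (suc b) f = ¬¬-map (λ c → colourable-withoutNewEdge c f) col
    minimal (suc a) zero    f = ¬¬-map
      (λ c → colourable-⊆ {E = del F (suc a) zero} {del F zero (suc a)} (map₂ (_∘ Sum.swap))
               (colourable-withoutNewEdge c (F-sym {suc a} {zero} f))) col
    minimal (suc a) (suc b) f = old f

critical-spans : {G : Graph} → Critical G → ∀ {p q} → Adj G p q → Spans (del (Adj G) p q)
critical-spans crit e c-sym good = Spanning.spanning crit e c-sym good

critical-con1 : {G : Graph} → Critical G → ∀ {u v w} → u ≢ v → u ≢ w → Adj G v w →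
                Critical (con1 G u v w)
critical-con1 {G} crit {u} {v} {w} u≢v u≢w e =
  con1-critical adj? neighbour (critical-spans crit e) (minimal e)
    λ {a} {b} f → ¬¬-map (colourable-withoutOldEdge {a} {b} f) (minimal {a} {b} (proj₁ f))
  where
  open Critical crit
  open Con1 G u v w u≢v u≢w e

-- Edges at the second new vertex are covered by `con1-critical`. There remain the edges from the
-- first new vertex to `G`, treated by `without-xp`, and those of `G`, where a splitting is extended
-- over one new vertex after the other.
critical-con2 : {G : Graph} → Critical G → ∀ {v w} → Adj G v w → Critical (con2 G v w)
critical-con2 {G} crit {v} {w} e =
  con1-critical K? K-neighbour (λ {c} → K-spans {c}) K-colourable λ {a} {b} → old a b
  where
  open Critical crit
  K : Graph
  K = addVertex G (λ j → j ≡ v ⊎ j ≡ w)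
  open Con1 K zero (suc v) (suc w) (λ ()) (λ ()) e

  K⁻ : FinRel (suc (n G))
  K⁻ = del (Adj K) (suc v) (suc w)
  K⁻-sym : Symmetric K⁻
  K⁻-sym {i} {j} = del-sym {T = Adj K} (λ {i} {j} → sym K {i} {j}) {x = i} {j}
  C : FinRel (suc (suc (n G)))
  C = Adj (con2 G v w)
  C-sym : Symmetric C
  C-sym {i} {j} = sym (con2 G v w) {i} {j}

  v≢w : v ≢ w
  v≢w refl = irrefl G e

  K? : Decidable (Adj K)
  K? = addVertex? G adj? λ j → j ≟ v ⊎-dec j ≟ w

  K-neighbour : ∀ a → ∃[ b ] Adj K a b
  K-neighbour zero    = suc v , inj₁ refl
  K-neighbour (suc a) = let (b , t) = neighbour a in suc b , t

  K-colourable : ¬ ¬ Colourable K⁻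
  K-colourable = ¬¬-map (λ col → colourable-twoNeighbours (λ {i} {j} → K⁻-sym {i} {j}) proj₁ v w proj₁
    (colourable-⊆ (λ (t , ne) → t , ne ∘ same-cong suc) col)) (minimal e)

  -- The two edges at the new vertex get different colours, so it is joined to G in both classes.
  K-spans : Spans K⁻
  K-spans {c} c-sym good h x y = to-v x ◅◅ reverse T-sym (to-v y)
    where
    T-sym : Symmetric (Class K⁻ c h)
    T-sym {i} {j} = class-sym {E = K⁻} (λ {i} {j} → K⁻-sym {i} {j}) c-sym {x = i} {j}
    keep : del (Adj G) v w ⇒ Old K⁻
    keep (t , ne) = t , ne ∘ same-injective suc-injective
    G-spans : ∀ h x y → Star (Class (Old K⁻) (λ i j → c (suc i) (suc j)) h) x y
    G-spans h x y = Star-map (λ (t , r) → keep t , r)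
      (critical-spans crit e (λ i j → c-sym _ _)
        (good-pullback {F = K⁻} suc suc-injective keep good) h x y)
    new : ∀ {a} → a ≡ v ⊎ a ≡ w → K⁻ zero (suc a)
    new N = N , λ { (inj₁ (() , _)) ; (inj₂ (() , _)) }
    differ : c zero (suc v) ≢ c zero (suc w)
    differ = new-edges-differ {F = K⁻} (λ {i} {j} → K⁻-sym {i} {j}) proj₁ c-sym good v≢w
      (new (inj₁ refl)) (new (inj₂ refl)) λ h → G-spans h w v
    exit : ∃[ t ] Class K⁻ c h zero (suc t)
    exit with c zero (suc v) Bool.≟ h
    ... | yes p = v , new (inj₁ refl) , p
    ... | no ¬p = w , new (inj₂ refl) , (begin
      c zero (suc w)       ≡⟨ Bool.¬-not (≢-sym differ) ⟩
      not (c zero (suc v)) ≡⟨ cong not (Bool.¬-not ¬p) ⟩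
      not (not h)          ≡⟨ Bool.not-involutive h ⟩
      h                    ∎)
      where open ≡-Reasoning
    to-v : ∀ x → Star (Class K⁻ c h) x (suc v)
    to-v zero    = let (t , s) = exit in s ◅ gmap suc id (G-spans h t v)
    to-v (suc x) = gmap suc id (G-spans h x v)

  -- Here x = suc zero keeps only the old neighbour q.  Colour xq true, x′q true, x′x and x′p false:
  -- x is then isolated in the class false of the graph without x′.
  without-xp : ∀ {p q} → p ≢ q → (∀ {a} → a ≡ v ⊎ a ≡ w → a ≡ p ⊎ a ≡ q) →
               Colourable (del (Adj G) v w) → Colourable (del C (suc zero) (suc (suc p)))
  without-xp {p} {q} p≢q nbrs (c , c-sym , good) =
    paint c₁ g , paint-sym c₁-sym g ,
    good-paint {F = D} (λ {i} {j} → D-sym {i} {j}) (λ t → proj₁ (proj₁ t)) c₁-sym good₁ g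
      λ x y → sep (place x) (place y)
    where
    D = del C (suc zero) (suc (suc p))
    D-sym : Symmetric D
    D-sym {i} {j} = del-sym {T = C} (λ {i} {j} → C-sym {i} {j}) {x = i} {j}
    only-q : ∀ {a} → Old D zero (suc a) → a ≡ q
    only-q ((N , _) , ne) with nbrs N
    ... | inj₁ refl = contradiction (inj₁ (refl , refl)) ne
    ... | inj₂ a≡q = a≡q
    c₁ : ColourFn (suc (n G))
    c₁ = paint c (λ _ → true)
    c₁-sym : SymColour c₁
    c₁-sym = paint-sym c-sym _
    good₁ : Good (Old D) c₁
    good₁ = good-paint {F = Old D} (λ {i} {j} → D-sym {suc i} {suc j}) (λ t → proj₁ (proj₁ t)) c-sym
      (good-⊆ {E = Old (Old D)} {del (Adj G) v w}
        (λ ((t , ne) , _) → t , ne ∘ same-cong suc ∘ same-cong suc) good)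
      (λ _ → true) λ x y a≢b → contradiction (trans (only-q x) (≡-sym (only-q y))) a≢b
    g : Fin (suc (n G)) → Bool
    g zero    = false
    g (suc j) = does (j ≟ q)
    Place : Fin (suc (n G)) → Set
    Place a = a ≡ zero ⊎ a ≡ suc p ⊎ a ≡ suc q
    place : ∀ {a} → D zero (suc a) → Place a
    place ((inj₁ r , _) , _) = inj₁ r
    place ((inj₂ (inj₁ refl) , _) , _) = inj₂ (Sum.map (cong suc) (cong suc) (nbrs (inj₁ refl)))
    place ((inj₂ (inj₂ refl) , _) , _) = inj₂ (Sum.map (cong suc) (cong suc) (nbrs (inj₂ refl)))
    is-q : ∀ {a} → Place a → g a ≡ true → a ≡ suc q
    is-q (inj₁ refl) ()
    is-q (inj₂ (inj₁ refl)) r with p ≟ q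
    ... | yes refl = refl
    ... | no _     = contradiction r λ ()
    is-q (inj₂ (inj₂ refl)) r = refl
    not-q : ∀ {a} → Place a → g a ≡ false → a ≡ zero ⊎ a ≡ suc p
    not-q (inj₁ r)        _ = inj₁ r
    not-q (inj₂ (inj₁ r)) _ = inj₂ r
    not-q (inj₂ (inj₂ refl)) r rewrite dec-true (q ≟ q) refl = contradiction r λ ()
    isolated : ∀ {b} → zero ≢ b → ¬ Star (Class (Old D) c₁ false) zero b
    isolated ne ε = ne refl
    isolated ne (_◅_ {j = zero} ((((() , _) , _)) , _) _)
    isolated ne (_◅_ {j = suc _} (_ , ()) _)
    back : ∀ {a b} → Star (Class (Old D) c₁ false) a b → Star (Class (Old D) c₁ false) b a
    back = reverse λ {i} {j} → class-sym {E = Old D} (λ {i} {j} → D-sym {suc i} {suc j}) c₁-sym {x = i} {j}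
    sep : ∀ {h a b} → Place a → Place b → a ≢ b → g a ≡ h → g b ≡ h → ¬ Star (Class (Old D) c₁ h) a b
    sep {true}  A B a≢b r s _ = a≢b (trans (is-q A r) (≡-sym (is-q B s)))
    sep {false} A B a≢b r s w with not-q A r | not-q B s
    ... | inj₁ refl | _         = isolated a≢b w
    ... | inj₂ _    | inj₁ refl = isolated (≢-sym a≢b) (back w)
    ... | inj₂ refl | inj₂ refl = a≢b refl

  old-x : ∀ {j} → j ≡ v ⊎ j ≡ w → ¬ ¬ Colourable (del C (suc zero) (suc (suc j)))
  old-x (inj₁ refl) = ¬¬-map (without-xp v≢w id) (minimal e)
  old-x (inj₂ refl) = ¬¬-map (without-xp (≢-sym v≢w) Sum.swap) (minimal e)

  old : ∀ a b → Old C a b → ¬ ¬ Colourable (del C (suc a) (suc b))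
  old zero    zero    (() , _)
  old zero    (suc j) (N , _) = old-x N
  old (suc i) zero    (N , _) = ¬¬-map
    (colourable-⊆ {E = del C (suc (suc i)) (suc zero)} {del C (suc zero) (suc (suc i))}
      (map₂ (_∘ Sum.swap))) (old-x N)
  old (suc i) (suc j) f = ¬¬-map
    (λ col → colourable-withoutOldEdge {suc i} {suc j} f
      (colourable-twoNeighbours
        (λ {a} {b} → del-sym {T = Adj K} (λ {i} {j} → sym K {i} {j}) {x = a} {b}) proj₁ v w proj₁
        (colourable-⊆ (λ (t , ne) → t , ne ∘ same-cong suc) col)))
    (minimal {i} {j} (proj₁ f))

-- Iterating construction (1) and `con3` list neighbours and deletions in different orders, so the
-- two adjacencies imply each other without being the same type.
critical-resp : {G : Graph} {F : FinRel (n G)} (F-sym : ∀ {i j} → F i j → F j i)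
  (F-irr : ∀ {i} → ¬ F i i) → Adj G ⇒ F → F ⇒ Adj G → Critical G →
  Critical (record { n = n G ; Adj = F ; sym = λ {i} {j} → F-sym {i} {j} ; irrefl = λ {i} → F-irr {i} })
critical-resp {G} {F} _ _ to from crit = record
  { adj?         = λ i j → map′ to from (adj? i j)
  ; uncolourable = uncolourable ∘ colourable-⊆ to
  ; minimal      = λ {a} {b} e → ¬¬-map
      (colourable-⊆ {E = del F a b} {del (Adj G) a b} (map₁ from)) (minimal (from e))
  ; neighbour    = map₂ to ∘ neighbour
  }
  where open Critical crit

-- Construction (3) is construction (1) on u v w followed by construction (1) on w v u, although wv
-- is no longer an edge then.
critical-con3 : {G : Graph} → Critical G → ∀ {u v w} → IsPath3 G u v w → Critical (con3 G u v w)
critical-con3 {G} crit {u} {v} {w} (uv , vw , u≢w) =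
  critical-resp {G₂} {Adj G₃} (λ {i} {j} → sym G₃ {i} {j}) (λ {i} → irrefl G₃ {i})
    (λ {i} {j} → to i j) (λ {i} {j} → from i j)
    (critical-con1 (critical-con1 crit u≢v u≢w vw)
      (λ p → v≢w (≡-sym (suc-injective p))) (λ p → u≢w (≡-sym (suc-injective p)))
      (sym G uv , λ s → new (same-injective suc-injective s)))
  where
  G₁ = con1 G u v w
  G₂ = con1 G₁ (suc w) (suc v) (suc u)
  G₃ = con3 G u v w
  u≢v : u ≢ v
  u≢v refl = irrefl G uv
  v≢w : v ≢ w
  v≢w refl = irrefl G vw
  new : ¬ SameEdge v u v w
  new (inj₁ (_ , p)) = u≢w p
  new (inj₂ (p , _)) = v≢w p
  rotate : {A B C : Set} → A ⊎ B ⊎ C → C ⊎ B ⊎ A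
  rotate (inj₁ a)        = inj₂ (inj₂ a)
  rotate (inj₂ (inj₁ b)) = inj₂ (inj₁ b)
  rotate (inj₂ (inj₂ c)) = inj₁ c
  to : ∀ i j → Adj G₂ i j → Adj G₃ i j
  to zero    zero    (() , _)
  to zero    (suc j) (N , ne) = (rotate N , ne ∘ Sum.swap) , λ { (inj₁ (() , _)) ; (inj₂ (() , _)) }
  to (suc i) zero    (N , ne) = (rotate N , ne ∘ Sum.swap) , λ { (inj₁ (_ , ())) ; (inj₂ (_ , ())) }
  to (suc i) (suc j) ((t , ne) , ne′) = (t , ne′ ∘ Sum.swap) , ne ∘ same-injective suc-injective
  from : ∀ i j → Adj G₃ i j → Adj G₂ i j
  from zero    zero    ((() , _) , _)
  from zero    (suc j) ((N , ne) , _) = rotate N , ne ∘ Sum.swap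
  from (suc i) zero    ((N , ne) , _) = rotate N , ne ∘ Sum.swap
  from (suc i) (suc j) ((t , ne) , ne′) = (t , ne′ ∘ same-cong suc) , ne ∘ Sum.swap

theorem1p5 : (G : Graph) → InM G →
    ((u v w : _) → IsPath3 G u v w → InM (con1 G u v w))
    × ((v w : _) → Adj G v w → InM (con2 G v w))
    × ((u v w : _) → IsPath3 G u v w → InM (con3 G u v w))
theorem1p5 G inM =
  (λ u v w (uv , vw , u≢w) → critical⇒inM (con1 G u v w)
    (critical-con1 crit (λ { refl → irrefl G uv }) u≢w vw)) ,
  (λ v w vw → critical⇒inM (con2 G v w) (critical-con2 crit vw)) ,
  (λ u v w path → critical⇒inM (con3 G u v w) (critical-con3 crit path))
  where
  crit = inM⇒critical G inM
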